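{- Let $n\ge1$ and let $H=(h_1>h_2>\cdots>h_p=1)$ be a decreasing gap sequence. For an input $\sigma$ of length $n$, let $T_j(\sigma;H)$ be the number of exchanges made in pass $j$ when Shellsort with gaps $H$ is run on $\sigma$. Then for every input $\sigma$ and every $1\le j\le p$, $T_j(\sigma;H)\le D_j(n)$. Moreover, $$W_n(H)\ \le\ \mathfrak U_n(H):=\min_{0\le s\le p}\left(\sum_{j=1}^{s}D_j(n)+U_s(n)\right),$$ and $C_n(H)\le \mathfrak U_n(H)+np$.
   Context: Shellsort: a gap sequence is a decreasing sequence of positive integers $H=(h_1>h_2>\cdots>h_p=1)$. On an array of $n$ distinct keys (a permutation), pass $j$ runs ordinary insertion sort separately on each $h_j$-chain, i.e. on each set of positions with the same remainder modulo $h_j$: the key is repeatedly compared with the key $h_j$ positions before it, exchanging the two if they are out of order, until no exchange is needed or the start of the chain is reached. Passes are run for $j=1,2,\dots,p$. $W_n(H)$ and $C_n(H)$ are the worst-case (over all inputs of $n$ keys) total numbers of exchanges and of comparisons. For $0\le s\le p$, $S_s=\{\sum_{i=1}^s x_ih_i: x_i\in\mathbb N_0\}$ (so $S_0=\{0\}$). For $1\le j\le p$: $M_j=\lfloor (n-1)/h_j\rfloor$, $G_j(n)=\{1\le m\le M_j: mh_j\notin S_{j-1}\}$, $D_j(n)=\sum_{m\in G_j(n)}(n-mh_j)$. For $0\le s\le p$: $U_s(n)=\sum_{1\le d<n,\ d\notin S_s}(n-d)$. -}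

module Defs where

open import Data.Nat.Base
  using (ℕ; zero; suc; _+_; _*_; _∸_; _/_; _%_; _≤_; _<_; s≤s; NonZero)
import Data.Nat.Properties as ℕ
open import Data.Nat.ListAction using (sum)
open import Data.Fin.Base as Fin using (Fin; toℕ)
import Data.Fin.Properties as Fin
open import Data.List.Base as List
  using (List; []; _∷_; length; map; filter; take; upTo; applyUpTo; allFin; cartesianProductWith)
open import Data.List.Extrema.Nat using (max; min)
open import Data.List.Membership.Propositional using (_∈_)
open import Data.List.Membership.Propositional.Properties
  using (∈-allFin; ∈-cartesianProductWith⁺; ∈-filter⁺; ∈-filter⁻)
open import Data.List.Relation.Unary.Any using (here)
open import Data.Product.Base using (Σ-syntax; ∃; _×_; _,_; proj₂)
open import Data.Vec.Base as Vec using (Vec; []; _∷_; lookup; zipWith; fromList; _[_]≔_)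
open import Data.Vec.Relation.Unary.AllPairs using (allPairs?)
open import Data.Vec.Relation.Unary.Unique.Propositional using (Unique)
import Data.Vec.Relation.Unary.Unique.Propositional.Properties as Unique
open import Function.Base using (id)
open import Relation.Binary.PropositionalEquality
  using (_≡_; refl; sym; trans; cong)
open import Relation.Nullary using (yes; no; ¬?)
open import Relation.Nullary.Decidable using (map′; _×-dec_)
open import Relation.Unary using (Decidable)

-- The gap written h_j (1 ≤ j ≤ p) in the literature is  gap i  with
-- toℕ i = j - 1.  The field `last` also forces p ≥ 1.
record GapSequence (p : ℕ) : Set where
  field
    gap        : Fin p → ℕ
    positive   : ∀ j → NonZero (gap j)
    decreasing : ∀ {i j} → i Fin.< j → gap j < gap i
    last       : Σ[ j ∈ Fin p ] (suc (toℕ j) ≡ p × gap j ≡ 1)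

open GapSequence public

-- Position 0 is the leftmost; only the relative order of the keys matters,
-- so n distinct keys are modelled as duplicate-free vectors over Fin n.
Array : ℕ → Set
Array n = Vec (Fin n) n

record Outcome (n : ℕ) : Set where
  constructor outcome
  field
    array       : Array n
    exchanges   : ℕ
    comparisons : ℕ

open Outcome public

Procedure : ℕ → Set
Procedure n = Array n → Outcome n

infixl 5 _⨾_

_⨾_ : ∀ {n} → Outcome n → Procedure n → Outcome n
outcome a e c ⨾ f = outcome (array r) (e + exchanges r) (c + comparisons r)
  where r = f a

runAll : ∀ {n} → List (Procedure n) → Procedure n
runAll []       a = outcome a 0 0
runAll (f ∷ fs) a = f a ⨾ runAll fs

swap : ∀ {n} → Fin n → Fin n → Array n → Array n
swap i j a = (a [ i ]≔ lookup a j) [ j ]≔ lookup a i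

-- The list argument holds the chain positions preceding i, nearest first
-- (for an h-chain: i - h, i - 2h, …); it is empty at the start of the chain.
insert : ∀ {n} → Fin n → List (Fin n) → Procedure n
insert i []       a = outcome a 0 0
insert i (j ∷ js) a with lookup a i Fin.<? lookup a j
... | yes _ = outcome (swap i j a) 1 1 ⨾ insert j js
... | no  _ = outcome a 0 1

insertionSort : ∀ {n} → List (Fin n) → List (Fin n) → Procedure n
insertionSort done []         a = outcome a 0 0
insertionSort done (i ∷ todo) a = insert i done a ⨾ insertionSort (i ∷ done) todo

chain : ∀ n h .{{_ : NonZero h}} → ℕ → List (Fin n)
chain n h r = filter (λ i → toℕ i % h ℕ.≟ r) (allFin n)

pass : ∀ {n} h .{{_ : NonZero h}} → Procedure n
pass {n} h = runAll (map (λ r → insertionSort [] (chain n h r)) (upTo h))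

passAt : ∀ {n p} → GapSequence p → Fin p → Procedure n
passAt H j = pass (gap H j) {{positive H j}}

passes : ∀ {n p} → GapSequence p → List (Procedure n)
passes H = List.tabulate (passAt H)

shellsort : ∀ {n p} → GapSequence p → Procedure n
shellsort H = runAll (passes H)

arrayBefore : ∀ {n p} → GapSequence p → Fin p → Array n → Array n
arrayBefore H j σ = array (runAll (take (toℕ j) (passes H)) σ)

T : ∀ {n p} → GapSequence p → Fin p → Array n → ℕ
T H j σ = exchanges (passAt H j (arrayBefore H j σ))

vectors : ∀ {A : Set} → List A → ∀ m → List (Vec A m)
vectors xs zero    = [] ∷ []
vectors xs (suc m) = cartesianProductWith _∷_ xs (vectors xs m)

unique? : ∀ {n} → Decidable (Unique {A = Fin n} {n})
unique? = allPairs? (λ x y → ¬? (x Fin.≟ y))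

inputs : ∀ n → List (Array n)
inputs n = filter unique? (vectors (allFin n) n)

∈-vectors : ∀ {n m} (v : Vec (Fin n) m) → v ∈ vectors (allFin n) m
∈-vectors []      = here refl
∈-vectors (x ∷ v) = ∈-cartesianProductWith⁺ _∷_ (∈-allFin x) (∈-vectors v)

inputs-complete : ∀ {n} {σ : Array n} → Unique σ → σ ∈ inputs n
inputs-complete {σ = σ} = ∈-filter⁺ unique? (∈-vectors σ)

inputs-sound : ∀ {n} {σ : Array n} → σ ∈ inputs n → Unique σ
inputs-sound {n} σ∈ = proj₂ (∈-filter⁻ unique? {xs = vectors (allFin n) n} σ∈)

inputs-nonempty : ∀ n → Vec.tabulate id ∈ inputs n
inputs-nonempty n = inputs-complete (Unique.tabulate⁺ id)

-- `inputs n` is nonempty, so the base value 0 does not affect the maxima.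
W : ∀ n {p} → GapSequence p → ℕ
W n H = max 0 (map (λ σ → exchanges (shellsort H σ)) (inputs n))

C : ∀ n {p} → GapSequence p → ℕ
C n H = max 0 (map (λ σ → comparisons (shellsort H σ)) (inputs n))

Combination : List ℕ → ℕ → Set
Combination hs d =
  ∃ λ (x : Vec ℕ (length hs)) → Vec.sum (zipWith _*_ x (fromList hs)) ≡ d

combination? : ∀ hs → Decidable (Combination hs)
combination? []           d = map′ ([] ,_) (λ { ([] , eq) → eq }) (0 ℕ.≟ d)
combination? (zero ∷ hs)  d = map′ to from (combination? hs d)
  where
  to : Combination hs d → Combination (zero ∷ hs) d
  to (x , eq) = 0 ∷ x , eq
  from : Combination (zero ∷ hs) d → Combination hs d
  from (k ∷ x , eq) =
    x , trans (cong (_+ Vec.sum (zipWith _*_ x (fromList hs))) (sym (ℕ.*-zeroʳ k))) eq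
combination? (h@(suc _) ∷ hs) d = map′ to from
  (Fin.any? λ (k : Fin (suc d)) →
    toℕ k * h ℕ.≤? d ×-dec combination? hs (d ∸ toℕ k * h))
  where
  Split : Set
  Split = ∃ λ (k : Fin (suc d)) → toℕ k * h ≤ d × Combination hs (d ∸ toℕ k * h)
  to : Split → Combination (h ∷ hs) d
  to (k , kh≤d , x , eq) =
    toℕ k ∷ x , trans (cong (toℕ k * h +_) eq) (ℕ.m+[n∸m]≡n kh≤d)
  from : Combination (h ∷ hs) d → Split
  from (k ∷ x , refl) = Fin.fromℕ< k<1+d , split (Fin.toℕ-fromℕ< k<1+d)
    where
    rest = Vec.sum (zipWith _*_ x (fromList hs))
    kh≤d : k * h ≤ d
    kh≤d = ℕ.m≤m+n (k * h) rest
    k<1+d : k < suc d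
    k<1+d = s≤s (ℕ.≤-trans (ℕ.m≤m*n k h) kh≤d)
    split : ∀ {l} → l ≡ k → l * h ≤ d × Combination hs (d ∸ l * h)
    split refl = kh≤d , x , sym (ℕ.m+n∸m≡n (k * h) rest)

S : ∀ {p} → GapSequence p → ℕ → ℕ → Set
S H s = Combination (take s (List.tabulate (gap H)))

S? : ∀ {p} (H : GapSequence p) s → Decidable (S H s)
S? H s = combination? (take s (List.tabulate (gap H)))

M : ∀ n {p} → GapSequence p → Fin p → ℕ
M n H j = _/_ (n ∸ 1) (gap H j) {{positive H j}}

-- With j counted from 0, the semigroup generated by the earlier gaps is
-- S H (toℕ j).
G : ∀ n {p} → GapSequence p → Fin p → List ℕ
G n H j = filter (λ m → ¬? (S? H (toℕ j) (m * gap H j))) (applyUpTo suc (M n H j))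

D : ∀ n {p} → GapSequence p → Fin p → ℕ
D n H j = sum (map (λ m → n ∸ m * gap H j) (G n H j))

U : ∀ n {p} → GapSequence p → ℕ → ℕ
U n H s = sum (map (n ∸_) (filter (λ d → ¬? (S? H s d)) (applyUpTo suc (n ∸ 1))))

bound : ∀ n {p} → GapSequence p → ℕ → ℕ
bound n H s = sum (take s (List.tabulate (D n H))) + U n H s

-- The base value of `min` is the s = 0 term, so it does not affect the minimum.
𝔘 : ∀ n {p} → GapSequence p → ℕ
𝔘 n {p} H = min (bound n H 0) (map (bound n H) (upTo (suc p)))

{-# OPTIONS --safe #-}

-- Exchanging an out-of-order pair of positions removes at least one inversion, and if both
-- positions lie in the same class modulo h it removes one among the pairs congruent modulo h.
-- So pass j makes at most as many exchanges as there are inversions at distances divisible by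
-- h_j, and all passes after the s-th together at most as many as there are inversions.  A pass
-- sorts its chains and keeps every earlier k-sortedness, so before pass j no inversion has a
-- distance in S_{j-1}; counting the pairs at the remaining distances gives D_j and U_s.  Each
-- insertion makes at most one comparison that is not followed by an exchange.
module Submission where

open import Defs
open import Algebra.Properties.CommutativeSemigroup using (interchange; x∙yz≈y∙xz)
open import Data.Bool.Base using (if_then_else_)
open import Data.Fin.Base as Fin using (Fin; toℕ; fromℕ<)
import Data.Fin.Properties as Fin
open import Data.List.Base
  using (List; []; _∷_; _++_; _ʳ++_; map; filter; length; take; drop; reverse; tabulate; allFin;
         applyUpTo; upTo)
open import Data.List.Extrema.Nat using (max≤v⁺; v≤min⁺)
open import Data.List.Membership.Propositional using (_∈_)
open import Data.List.Membership.Propositional.Properties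
  using (∈-allFin; ∈-applyUpTo⁺; ∈-filter⁺; ∈-map⁺; ∈-upTo⁺)
open import Data.List.Properties
  using (length-tabulate; map-tabulate; map-∘; map-upTo; take++drop≡id; unfold-reverse)
open import Data.List.Relation.Unary.All as All using (All; []; _∷_)
import Data.List.Relation.Unary.All.Properties as All
open import Data.List.Relation.Unary.AllPairs as AllPairs using (AllPairs; []; _∷_)
import Data.List.Relation.Unary.AllPairs.Properties as AllPairs
open import Data.List.Relation.Unary.Any using (here; there)
import Data.List.Relation.Unary.Any.Properties as Any
open import Data.Nat.Base
open import Data.Nat.DivMod
open import Data.Nat.ListAction using (sum)
open import Data.Nat.Properties
open import Data.Product.Base using (∃; _×_; _,_; proj₁; proj₂)
open import Data.Sum.Base using (_⊎_; inj₁; inj₂)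
open import Data.Vec.Base using (Vec; []; _∷_; lookup; _[_]≔_)
open import Data.Vec.Properties using (lookup∘update; lookup∘update′)
open import Data.Vec.Relation.Unary.Unique.Propositional using (Unique)
open import Function.Base using (_∘_; flip; id)
open import Relation.Binary.PropositionalEquality
open import Relation.Nullary using (Dec; yes; no; does; ¬_; contradiction)
open import Relation.Nullary.Decidable using (_×-dec_; ¬?)

private
  variable
    A : Set
    n p : ℕ

-- Indicators and finite sums of natural numbers.

-- Only the Boolean `does` is read, so indicators whose tests agree after cancelling a `suc` are
-- equal by computation; `∑-diagonal` and `∑-shifted` recurse on this.
𝟙 : {P : Set} → Dec P → ℕ
𝟙 P? = if does P? then 1 else 0

𝟙-mono : {P Q : Set} (P? : Dec P) (Q? : Dec Q) → (P → Q) → 𝟙 P? ≤ 𝟙 Q?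
𝟙-mono (no _)  Q?     P⇒Q = z≤n
𝟙-mono (yes _) (yes _) P⇒Q = ≤-refl
𝟙-mono (yes P) (no ¬Q) P⇒Q = contradiction (P⇒Q P) ¬Q

𝟙-true : {P : Set} (P? : Dec P) → P → 𝟙 P? ≡ 1
𝟙-true (yes _) _ = refl
𝟙-true (no ¬P) P = contradiction P ¬P

𝟙-false : {P : Set} (P? : Dec P) → ¬ P → 𝟙 P? ≡ 0
𝟙-false (yes P) ¬P = contradiction P ¬P
𝟙-false (no _)  _  = refl

𝟙-≤ : {P : Set} (P? : Dec P) {k : ℕ} → (P → 1 ≤ k) → 𝟙 P? ≤ k
𝟙-≤ (yes P) P⇒1≤k = P⇒1≤k P
𝟙-≤ (no _)  _     = z≤n

∑ : ℕ → (ℕ → ℕ) → ℕ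
∑ N g = sum (applyUpTo g N)

∑-mono : ∀ N {g′ g} → (∀ z → z < N → g′ z ≤ g z) → ∑ N g′ ≤ ∑ N g
∑-mono zero    g′≤g = z≤n
∑-mono (suc N) g′≤g = +-mono-≤ (g′≤g 0 z<s) (∑-mono N λ z z<N → g′≤g (suc z) (s<s z<N))

∑-zero : ∀ N {g} → (∀ z → g z ≡ 0) → ∑ N g ≡ 0
∑-zero zero    g≡0 = refl
∑-zero (suc N) g≡0 = cong₂ _+_ (g≡0 0) (∑-zero N (g≡0 ∘ suc))

∑-distrib-+ : ∀ N g g′ → ∑ N (λ z → g z + g′ z) ≡ ∑ N g + ∑ N g′
∑-distrib-+ zero    g g′ = refl
∑-distrib-+ (suc N) g g′ =
  trans (cong (g 0 + g′ 0 +_) (∑-distrib-+ N (g ∘ suc) (g′ ∘ suc)))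
        (interchange +-commutativeSemigroup (g 0) (g′ 0) _ _)

∑-cong : ∀ N {g g′} → (∀ z → g z ≡ g′ z) → ∑ N g ≡ ∑ N g′
∑-cong zero    g≡g′ = refl
∑-cong (suc N) g≡g′ = cong₂ _+_ (g≡g′ 0) (∑-cong N (g≡g′ ∘ suc))

∑-split : ∀ k m g → ∑ (k + m) g ≡ ∑ k g + ∑ m (g ∘ (k +_))
∑-split zero    m g = refl
∑-split (suc k) m g = trans (cong (g 0 +_) (∑-split k m (g ∘ suc))) (sym (+-assoc (g 0) _ _))

∑-extend : ∀ {m N} → m ≤ N → ∀ g → ∑ m g ≤ ∑ N g
∑-extend {m} {N} m≤N g = begin
  ∑ m g                              ≤⟨ m≤m+n _ _ ⟩
  ∑ m g + ∑ (N ∸ m) (g ∘ (m +_))     ≡⟨ ∑-split m (N ∸ m) g ⟨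
  ∑ (m + (N ∸ m)) g                  ≡⟨ cong (λ k → ∑ k g) (m+[n∸m]≡n m≤N) ⟩
  ∑ N g                              ∎
  where open ≤-Reasoning

-- Serves `∑-pairUpdate` once the smaller index has been split off: `a` and `b` then carry the terms
-- of that index.
∑-pointUpdate : ∀ N {a b g′ g x} → x < N → (∀ z → z ≢ x → g′ z ≤ g z) →
                a + g′ x ≤ b + g x → a + ∑ N g′ ≤ b + ∑ N g
∑-pointUpdate (suc N) {a} {b} {g′} {g} {zero} _ g′≤g at-x = begin
  a + (g′ 0 + ∑ N (g′ ∘ suc))  ≡⟨ +-assoc a _ _ ⟨
  a + g′ 0 + ∑ N (g′ ∘ suc)    ≤⟨ +-mono-≤ at-x (∑-mono N λ z _ → g′≤g (suc z) λ ()) ⟩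
  b + g 0 + ∑ N (g ∘ suc)      ≡⟨ +-assoc b _ _ ⟩
  b + (g 0 + ∑ N (g ∘ suc))    ∎
  where open ≤-Reasoning
∑-pointUpdate (suc N) {a} {b} {g′} {g} {suc x} x<N g′≤g at-x = begin
  a + (g′ 0 + ∑ N (g′ ∘ suc))  ≡⟨ x∙yz≈y∙xz +-commutativeSemigroup a (g′ 0) _ ⟩
  g′ 0 + (a + ∑ N (g′ ∘ suc))  ≤⟨ +-mono-≤ (g′≤g 0 λ ()) (∑-pointUpdate N (s<s⁻¹ x<N)
                                    (λ z z≢x → g′≤g (suc z) (z≢x ∘ suc-injective)) at-x) ⟩
  g 0 + (b + ∑ N (g ∘ suc))    ≡⟨ x∙yz≈y∙xz +-commutativeSemigroup (g 0) b _ ⟩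
  b + (g 0 + ∑ N (g ∘ suc))    ∎
  where open ≤-Reasoning

-- Fits an exchange of two positions: the terms at `x` and `y` may trade places, so they are
-- comparable only jointly. The surplus `a` carries the strict decrease.
∑-pairUpdate : ∀ N {a g′ g x y} → x < y → y < N → (∀ z → z ≢ x → z ≢ y → g′ z ≤ g z) →
               a + (g′ x + g′ y) ≤ g x + g y → a + ∑ N g′ ≤ ∑ N g
∑-pairUpdate (suc N) {a} {g′} {g} {zero} {suc y} x<y y<N g′≤g at-xy = begin
  a + (g′ 0 + ∑ N (g′ ∘ suc))  ≡⟨ +-assoc a _ _ ⟨
  a + g′ 0 + ∑ N (g′ ∘ suc)    ≤⟨ ∑-pointUpdate N (s<s⁻¹ y<N)
                                    (λ z z≢y → g′≤g (suc z) (λ ()) (z≢y ∘ suc-injective))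
                                    (≤-trans (≤-reflexive (+-assoc a _ _)) at-xy) ⟩
  g 0 + ∑ N (g ∘ suc)          ∎
  where open ≤-Reasoning
∑-pairUpdate (suc N) {a} {g′} {g} {suc x} {suc y} x<y y<N g′≤g at-xy = begin
  a + (g′ 0 + ∑ N (g′ ∘ suc))  ≡⟨ x∙yz≈y∙xz +-commutativeSemigroup a (g′ 0) _ ⟩
  g′ 0 + (a + ∑ N (g′ ∘ suc))  ≤⟨ +-mono-≤ (g′≤g 0 (λ ()) λ ())
                                    (∑-pairUpdate N (s<s⁻¹ x<y) (s<s⁻¹ y<N)
                                      (λ z z≢x z≢y → g′≤g (suc z) (z≢x ∘ suc-injective)
                                                                  (z≢y ∘ suc-injective)) at-xy) ⟩
  g 0 + ∑ N (g ∘ suc)          ∎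
  where open ≤-Reasoning

-- Effect of an exchange on inversions and on class counts.

record Swapped (x y : ℕ) (f f′ : ℕ → ℕ) : Set where
  field
    at-x      : f′ x ≡ f y
    at-y      : f′ y ≡ f x
    elsewhere : ∀ {z} → z ≢ x → z ≢ y → f′ z ≡ f z

Swapped-sym : ∀ {x y f f′} → Swapped x y f f′ → Swapped x y f′ f
Swapped-sym s = record
  { at-x = sym at-y ; at-y = sym at-x ; elsewhere = λ z≢x z≢y → sym (elsewhere z≢x z≢y) }
  where open Swapped s

module _ (κ : ℕ → ℕ) where

  -- The labelling `κ` selects the pairs that are counted: `_% h` gives the pairs inside chains, a
  -- constant labelling gives all pairs.
  Inversion : (ℕ → ℕ) → ℕ → ℕ → Set
  Inversion f u v = u < v × κ u ≡ κ v × f v < f u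

  inversion? : ∀ f u v → Dec (Inversion f u v)
  inversion? f u v = u <? v ×-dec κ u ≟ κ v ×-dec f v <? f u

  inversions : ℕ → (ℕ → ℕ) → ℕ
  inversions N f = ∑ N λ u → ∑ N λ v → 𝟙 (inversion? f u v)

  module _ {f f′ x y} (x<y : x < y) (κx≡κy : κ x ≡ κ y) (fy<fx : f y < f x)
           (s : Swapped x y f f′) where
    open Swapped s

    private
      I I′ : ℕ → ℕ → ℕ
      I  u v = 𝟙 (inversion? f u v)
      I′ u v = 𝟙 (inversion? f′ u v)

      I′≤I : ∀ u v u′ v′ → (Inversion f′ u v → Inversion f u′ v′) → I′ u v ≤ I u′ v′
      I′≤I u v u′ v′ = 𝟙-mono (inversion? f′ u v) (inversion? f u′ v′)

      I′≡0 : ∀ u v → ¬ Inversion f′ u v → I′ u v ≡ 0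
      I′≡0 u v = 𝟙-false (inversion? f′ u v)

      fx′<fy′ : f′ x < f′ y
      fx′<fy′ = subst₂ _<_ (sym at-x) (sym at-y) fy<fx

      -- Here `z` is the left end. Left of `x`, its pairs with `x` and `y` trade places. Right of
      -- `x`, only the pair with `y` can count, and the exchange raises the value at `y`.
      column : ∀ z → z ≢ x → z ≢ y → I′ z x + I′ z y ≤ I z x + I z y
      column z z≢x z≢y with z <? x
      ... | yes z<x = ≤-trans
        (+-mono-≤
          (I′≤I z x z y λ (_ , κz , lt) →
            <-trans z<x x<y , trans κz κx≡κy , subst₂ _<_ at-x (elsewhere z≢x z≢y) lt)
          (I′≤I z y z x λ (_ , κz , lt) →
            z<x , trans κz (sym κx≡κy) , subst₂ _<_ at-y (elsewhere z≢x z≢y) lt))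
        (≤-reflexive (+-comm (I z y) (I z x)))
      ... | no z≮x = +-mono-≤ {I′ z x} (≤-trans (≤-reflexive (I′≡0 z x (z≮x ∘ proj₁))) z≤n)
        (I′≤I z y z y λ (z<y , κz , lt) →
          z<y , κz , <-trans fy<fx (subst₂ _<_ at-y (elsewhere z≢x z≢y) lt))

      -- The mirror image, with `z` as the right end: beyond `y` the two pairs trade places;
      -- otherwise only the pair with `x` can count, and the value at `x` has dropped.
      row : ∀ z → z ≢ x → z ≢ y → I′ x z + I′ y z ≤ I x z + I y z
      row z z≢x z≢y with y <? z
      ... | yes y<z = ≤-trans
        (+-mono-≤
          (I′≤I x z y z λ (_ , κz , lt) →
            y<z , trans (sym κx≡κy) κz , subst₂ _<_ (elsewhere z≢x z≢y) at-x lt)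
          (I′≤I y z x z λ (_ , κz , lt) →
            <-trans x<y y<z , trans κx≡κy κz , subst₂ _<_ (elsewhere z≢x z≢y) at-y lt))
        (≤-reflexive (+-comm (I y z) (I x z)))
      ... | no y≮z = +-mono-≤
        (I′≤I x z x z λ (x<z , κz , lt) →
          x<z , κz , <-trans (subst₂ _<_ (elsewhere z≢x z≢y) at-x lt) fy<fx)
        (≤-trans (≤-reflexive (I′≡0 y z (y≮z ∘ proj₁))) z≤n)

      -- Of the four pairs with both ends in `x`, `y`, only `(x , y)` is increasing, and it is
      -- inverted before the exchange but not after; this is the inversion that is lost.
      corner : 1 + ((I′ x x + I′ y x) + (I′ x y + I′ y y)) ≤ (I x x + I y x) + (I x y + I y y)
      corner = begin
        1 + ((I′ x x + I′ y x) + (I′ x y + I′ y y))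
          ≡⟨ cong suc (cong₂ _+_ (cong₂ _+_ (I′≡0 x x (n≮n x ∘ proj₁))
                                            (I′≡0 y x (<-asym x<y ∘ proj₁)))
                                 (cong₂ _+_ (I′≡0 x y (<-asym fx′<fy′ ∘ proj₂ ∘ proj₂))
                                            (I′≡0 y y (n≮n y ∘ proj₁)))) ⟩
        1
          ≡⟨ 𝟙-true (inversion? f x y) (x<y , κx≡κy , fy<fx) ⟨
        I x y
          ≤⟨ m≤m+n _ _ ⟩
        I x y + I y y
          ≤⟨ m≤n+m (I x y + I y y) (I x x + I y x) ⟩
        (I x x + I y x) + (I x y + I y y) ∎
        where open ≤-Reasoning

    inversions-swap : ∀ {N} → y < N → suc (inversions N f′) ≤ inversions N f
    inversions-swap {N} y<N = ∑-pairUpdate N x<y y<N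
      (λ u u≢x u≢y → ∑-pairUpdate N {0} x<y y<N
        (λ v v≢x v≢y → I′≤I u v u v λ (u<v , κu , lt) →
          u<v , κu , subst₂ _<_ (elsewhere v≢x v≢y) (elsewhere u≢x u≢y) lt)
        (column u u≢x u≢y))
      -- The rows of `x` and `y` are comparable only after being added, so they are merged into one
      -- sum, which is again a pair update, with `corner` at its two special columns.
      (subst₂ _≤_ (cong suc (∑-distrib-+ N (I′ x) (I′ y))) (∑-distrib-+ N (I x) (I y))
        (∑-pairUpdate N x<y y<N row corner))

  -- For all `t` together these counts encode the multiset of keys of class `c`, which exchanges
  -- inside classes leave unchanged.
  countBelow : ℕ → (ℕ → ℕ) → ℕ → ℕ → ℕ
  countBelow N f c t = ∑ N λ q → 𝟙 (κ q ≟ c ×-dec f q ≤? t)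

  countBelow-swap-≤ : ∀ {N f f′ x y} → x < y → y < N → κ x ≡ κ y → Swapped x y f f′ →
                      ∀ c t → countBelow N f′ c t ≤ countBelow N f c t
  countBelow-swap-≤ {N} {f} {f′} {x} {y} x<y y<N κx≡κy s c t =
    ∑-pairUpdate N {0} {below f′} {below f} x<y y<N
      (λ z z≢x z≢y → below-mono z z λ (κz , le) → κz , subst (_≤ t) (elsewhere z≢x z≢y) le)
      (≤-trans
        (+-mono-≤
          (below-mono x y λ (κx , le) → trans (sym κx≡κy) κx , subst (_≤ t) at-x le)
          (below-mono y x λ (κy , le) → trans κx≡κy κy , subst (_≤ t) at-y le))
        (≤-reflexive (+-comm (below f y) (below f x))))
    where
    open Swapped s
    below : (ℕ → ℕ) → ℕ → ℕ
    below g q = 𝟙 (κ q ≟ c ×-dec g q ≤? t)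
    below-mono : ∀ z z′ → (κ z ≡ c × f′ z ≤ t → κ z′ ≡ c × f z′ ≤ t) → below f′ z ≤ below f z′
    below-mono z z′ = 𝟙-mono (κ z ≟ c ×-dec f′ z ≤? t) (κ z′ ≟ c ×-dec f z′ ≤? t)

  -- `Swapped` is symmetric, so the one-sided inequality can be used in both directions.
  countBelow-swap : ∀ {N f f′ x y} → x < y → y < N → κ x ≡ κ y → Swapped x y f f′ →
                    ∀ c t → countBelow N f c t ≡ countBelow N f′ c t
  countBelow-swap x<y y<N κx≡κy s c t = ≤-antisym
    (countBelow-swap-≤ x<y y<N κx≡κy (Swapped-sym s) c t)
    (countBelow-swap-≤ x<y y<N κx≡κy s c t)

-- Counting inversions by their distance.

∑-diagonal : ∀ N c → ∑ N (λ v → 𝟙 (c ≟ v)) ≤ 𝟙 (c <? N)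
∑-diagonal zero    c       = z≤n
∑-diagonal (suc N) zero    = ≤-reflexive (cong suc (∑-zero N λ _ → refl))
∑-diagonal (suc N) (suc c) = ∑-diagonal N c

-- The bound `m` is separate from the range `N` because the induction lowers `m` and `d` together
-- while `N` stays.
∑-shifted : ∀ N m d → ∑ N (λ u → 𝟙 (d + u <? m)) ≤ m ∸ d
∑-shifted N       zero    d       = ≤-trans (≤-reflexive (∑-zero N λ _ → refl)) z≤n
∑-shifted N       (suc m) (suc d) = ∑-shifted N m d
∑-shifted zero    (suc m) zero    = z≤n
∑-shifted (suc N) (suc m) zero    = s≤s (∑-shifted N m zero)

-- Occurrences are counted instead of testing membership, so that the double sum splits over the
-- entries of `ds`.
multiplicity : List ℕ → ℕ → ℕ → ℕ
multiplicity ds u v = sum (map (λ d → 𝟙 (d + u ≟ v)) ds)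

∈⇒1≤multiplicity : ∀ {ds d u v} → d ∈ ds → d + u ≡ v → 1 ≤ multiplicity ds u v
∈⇒1≤multiplicity {u = u} {v} (here {x = d} refl) eq =
  ≤-trans (≤-reflexive (sym (𝟙-true (d + u ≟ v) eq))) (m≤m+n _ _)
∈⇒1≤multiplicity (there d∈ds) eq = ≤-trans (∈⇒1≤multiplicity d∈ds eq) (m≤n+m _ _)

∑∑-multiplicity : ∀ N ds → ∑ N (λ u → ∑ N (multiplicity ds u)) ≤ sum (map (N ∸_) ds)
∑∑-multiplicity N []       = ≤-reflexive (∑-zero N λ _ → ∑-zero N λ _ → refl)
∑∑-multiplicity N (d ∷ ds) = begin
  ∑ N (λ u → ∑ N (λ v → δ u v + multiplicity ds u v))
    ≡⟨ ∑-cong N (λ u → ∑-distrib-+ N (δ u) (multiplicity ds u)) ⟩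
  ∑ N (λ u → ∑ N (δ u) + ∑ N (multiplicity ds u))
    ≡⟨ ∑-distrib-+ N _ _ ⟩
  ∑ N (λ u → ∑ N (δ u)) + ∑ N (λ u → ∑ N (multiplicity ds u))
    ≤⟨ +-mono-≤ (≤-trans (∑-mono N λ u _ → ∑-diagonal N (d + u)) (∑-shifted N N d))
                (∑∑-multiplicity N ds) ⟩
  N ∸ d + sum (map (N ∸_) ds) ∎
  where
  open ≤-Reasoning
  δ : ℕ → ℕ → ℕ
  δ u v = 𝟙 (d + u ≟ v)

-- Each inversion is charged to an entry of `ds` equal to its distance, and at most `N ∸ d` pairs of
-- positions below `N` have distance `d`. With the admissible distances as `ds` this yields both `D`
-- and `U`.
inversions-≤ : ∀ κ N f ds →
  (∀ {u v} → v < N → Inversion κ f u v → ∃ λ d → d ∈ ds × d + u ≡ v) →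
  inversions κ N f ≤ sum (map (N ∸_) ds)
inversions-≤ κ N f ds distance = ≤-trans
  (∑-mono N λ u _ → ∑-mono N λ v v<N → 𝟙-≤ (inversion? κ f u v) λ inv →
    let d , d∈ds , eq = distance v<N inv in ∈⇒1≤multiplicity {ds} d∈ds eq)
  (∑∑-multiplicity N ds)

-- Sortedness at a distance, and its preservation by a pass.

Sorted : ℕ → (ℕ → ℕ) → Set
Sorted d f = ∀ q → f q ≤ f (d + q)

Sorted-+ : ∀ {c d f} → Sorted c f → Sorted d f → Sorted (c + d) f
Sorted-+ {c} {d} {f} c-sorted d-sorted q =
  ≤-trans (d-sorted q) (≤-trans (c-sorted (d + q)) (≤-reflexive (cong f (sym (+-assoc c d q)))))

Sorted-* : ∀ {d f} k → Sorted d f → Sorted (k * d) f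
Sorted-* zero    d-sorted = λ _ → ≤-refl
Sorted-* (suc k) d-sorted = Sorted-+ d-sorted (Sorted-* k d-sorted)

-- The distances at which `f` is sorted contain 0 and are closed under addition, hence contain the
-- semigroup generated by `hs`.
Sorted-combination : ∀ {hs d f} → All (λ h → Sorted h f) hs → Combination hs d → Sorted d f
Sorted-combination []              ([]    , refl) = λ _ → ≤-refl
Sorted-combination (h-sorted ∷ ss) (k ∷ x , refl) =
  Sorted-+ (Sorted-* k h-sorted) (Sorted-combination ss (x , refl))

module _ (h : ℕ) .{{_ : NonZero h}} where

  %-congʳ-+ : ∀ k {q r} → q % h ≡ r % h → (k + q) % h ≡ (k + r) % h
  %-congʳ-+ k {q} {r} eq = begin
    (k + q) % h          ≡⟨ %-distribˡ-+ k q h ⟩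
    (k % h + q % h) % h  ≡⟨ cong (λ z → (k % h + z) % h) eq ⟩
    (k % h + r % h) % h  ≡⟨ %-distribˡ-+ k r h ⟨
    (k + r) % h          ∎
    where open ≡-Reasoning

  -- Modulo `h`, the number `k * pred h` is an additive inverse of `k`; adding it to both sides
  -- removes `k`.
  %-cancelʳ-+ : ∀ k {q r} → (k + q) % h ≡ (k + r) % h → q % h ≡ r % h
  %-cancelʳ-+ k {q} {r} eq =
    trans (sym (complement q)) (trans (%-congʳ-+ (k * pred h) eq) (complement r))
    where
    open ≡-Reasoning
    complement : ∀ z → (k * pred h + (k + z)) % h ≡ z % h
    complement z = begin
      (k * pred h + (k + z)) % h  ≡⟨ cong (_% h) (+-assoc (k * pred h) k z) ⟨
      (k * pred h + k + z) % h    ≡⟨ cong (λ m → (m + z) % h) (+-comm (k * pred h) k) ⟩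
      (k + k * pred h + z) % h    ≡⟨ cong (λ m → (m + z) % h) (*-suc k (pred h)) ⟨
      (k * suc (pred h) + z) % h  ≡⟨ cong (λ m → (k * m + z) % h) (suc-pred h) ⟩
      (k * h + z) % h             ≡⟨ cong (_% h) (+-comm (k * h) z) ⟩
      (z + k * h) % h             ≡⟨ [m+kn]%n≡m%n z k h ⟩
      z % h                       ∎

  congruent⇒multiple : ∀ {q r} → q ≤ r → q % h ≡ r % h → ∃ λ m → m * h + q ≡ r
  congruent⇒multiple {q} {r} q≤r eq = r / h ∸ q / h , (begin
    (r / h ∸ q / h) * h + q                    ≡⟨ cong ((r / h ∸ q / h) * h +_) q≡ ⟩
    (r / h ∸ q / h) * h + (q / h * h + r % h)  ≡⟨ +-assoc ((r / h ∸ q / h) * h) _ _ ⟨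
    (r / h ∸ q / h) * h + q / h * h + r % h    ≡⟨ cong (_+ r % h) (*-distribʳ-+ h (r / h ∸ q / h) (q / h)) ⟨
    (r / h ∸ q / h + q / h) * h + r % h        ≡⟨ cong (λ z → z * h + r % h) (m∸n+n≡m (/-monoˡ-≤ h q≤r)) ⟩
    r / h * h + r % h                          ≡⟨ +-comm (r / h * h) _ ⟩
    r % h + r / h * h                          ≡⟨ m≡m%n+[m/n]*n r h ⟨
    r                                          ∎)
    where
    open ≡-Reasoning
    q≡ : q ≡ q / h * h + r % h
    q≡ = trans (m≡m%n+[m/n]*n q h) (trans (+-comm (q % h) _) (cong (q / h * h +_) eq))

  Sorted-congruent : ∀ {f q r} → Sorted h f → q ≤ r → q % h ≡ r % h → f q ≤ f r
  Sorted-congruent {f} {q} h-sorted q≤r eq with congruent⇒multiple q≤r eq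
  ... | m , refl = Sorted-* m h-sorted q

  -- If f′ i > t = f′ (k + i), compare the numbers of keys ≤ t in the classes of i and k + i
  -- modulo h: k-sortedness of f makes the latter exceed the former by at most
  -- #{q < k : q ≡ k + i}, whereas in f′ it exceeds it by more.
  Sorted-preserved : ∀ {N k f f′} → Sorted k f → Sorted h f′ →
    (∀ q → f′ q ≤ N) → (∀ {q} → f′ q < N → q < N) →
    (∀ c t → countBelow (_% h) N f c t ≡ countBelow (_% h) N f′ c t) →
    Sorted k f′
  Sorted-preserved {N} {k} {f} {f′} k-sorted h-sorted bounded inside counts i
    with f′ i ≤? f′ (k + i)
  ... | yes le = le
  ... | no  gt = contradiction (+-cancelˡ-≤ (∑ k (χ r′)) _ _ excess) 1+n≰n
    where
    t r r′ : ℕ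
    t  = f′ (k + i)
    r  = i % h
    r′ = (k + i) % h
    χ : ℕ → ℕ → ℕ
    χ c q = 𝟙 (q % h ≟ c)
    below : (ℕ → ℕ) → ℕ → ℕ → ℕ
    below g c q = 𝟙 (q % h ≟ c ×-dec g q ≤? t)
    t<f′i : t < f′ i
    t<f′i = ≰⇒> gt
    k+i<N : k + i < N
    k+i<N = inside (<-≤-trans t<f′i (bounded i))
    i≤N : i ≤ N
    i≤N = ≤-trans (m≤n+m i k) (<⇒≤ k+i<N)
    -- In the class of `i`, `h`-sortedness of `f′` makes every key from position `i` onwards exceed
    -- `t`.
    few : ∑ N (below f′ r) ≤ ∑ i (χ r)
    few = begin
      ∑ N (below f′ r)
        ≡⟨ cong (λ z → ∑ z (below f′ r)) (m+[n∸m]≡n i≤N) ⟨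
      ∑ (i + (N ∸ i)) (below f′ r)
        ≡⟨ ∑-split i (N ∸ i) (below f′ r) ⟩
      ∑ i (below f′ r) + ∑ (N ∸ i) (below f′ r ∘ (i +_))
        ≤⟨ +-mono-≤
             (∑-mono i λ q _ → 𝟙-mono (q % h ≟ r ×-dec f′ q ≤? t) (q % h ≟ r) proj₁)
             (≤-reflexive (∑-zero (N ∸ i) λ q → 𝟙-false ((i + q) % h ≟ r ×-dec f′ (i + q) ≤? t)
               λ (eq , le) → <⇒≱ t<f′i
                 (≤-trans (Sorted-congruent h-sorted (m≤m+n i q) (sym eq)) le))) ⟩
      ∑ i (χ r) + 0
        ≡⟨ +-identityʳ _ ⟩
      ∑ i (χ r) ∎
      where open ≤-Reasoning
    excess : ∑ k (χ r′) + suc (∑ i (χ r)) ≤ ∑ k (χ r′) + ∑ i (χ r)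
    excess = begin
      ∑ k (χ r′) + suc (∑ i (χ r))
        ≡⟨ cong (∑ k (χ r′) +_) (+-comm 1 _) ⟩
      ∑ k (χ r′) + (∑ i (χ r) + 1)
        -- The extra 1 is position `i` itself, which lies in its own class.
        ≡⟨ cong (λ z → ∑ k (χ r′) + (∑ i (χ r) + (z + 0)))
             (𝟙-true ((i + 0) % h ≟ r) (cong (_% h) (+-identityʳ i))) ⟨
      ∑ k (χ r′) + (∑ i (χ r) + ∑ 1 (χ r ∘ (i +_)))
        ≡⟨ cong (∑ k (χ r′) +_) (∑-split i 1 (χ r)) ⟨
      ∑ k (χ r′) + ∑ (i + 1) (χ r)
        ≤⟨ +-monoʳ-≤ (∑ k (χ r′)) (∑-mono (i + 1) λ q _ →
             𝟙-mono (q % h ≟ r) ((k + q) % h ≟ r′) (%-congʳ-+ k)) ⟩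
      ∑ k (χ r′) + ∑ (i + 1) (χ r′ ∘ (k +_))
        ≡⟨ ∑-split k (i + 1) (χ r′) ⟨
      ∑ (k + (i + 1)) (χ r′)
        ≤⟨ ∑-mono (k + (i + 1)) (λ q q< →
             𝟙-mono (q % h ≟ r′) (q % h ≟ r′ ×-dec f′ q ≤? t) λ eq →
               eq , Sorted-congruent h-sorted (s≤s⁻¹ (subst (q <_) k+[i+1] q<)) eq) ⟩
      ∑ (k + (i + 1)) (below f′ r′)
        ≤⟨ ∑-extend (subst (_≤ N) (sym k+[i+1]) k+i<N) (below f′ r′) ⟩
      ∑ N (below f′ r′)
        ≡⟨ counts r′ t ⟨
      ∑ N (below f r′)
        -- With `k + N` positions, splitting off the first `k` leaves a full range of `N` shifted
        -- ones.
        ≤⟨ ∑-extend (m≤n+m N k) (below f r′) ⟩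
      ∑ (k + N) (below f r′)
        ≡⟨ ∑-split k N (below f r′) ⟩
      ∑ k (below f r′) + ∑ N (below f r′ ∘ (k +_))
        ≤⟨ +-mono-≤
             (∑-mono k λ q _ → 𝟙-mono (q % h ≟ r′ ×-dec f q ≤? t) (q % h ≟ r′) proj₁)
             (∑-mono N λ q _ → 𝟙-mono ((k + q) % h ≟ r′ ×-dec f (k + q) ≤? t)
               (q % h ≟ r ×-dec f q ≤? t)
               λ (eq , le) → %-cancelʳ-+ k eq , ≤-trans (k-sorted q) le) ⟩
      ∑ k (χ r′) + ∑ N (below f r)
        ≡⟨ cong (∑ k (χ r′) +_) (counts r t) ⟩
      ∑ k (χ r′) + ∑ N (below f′ r)
        ≤⟨ +-monoʳ-≤ (∑ k (χ r′)) few ⟩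
      ∑ k (χ r′) + ∑ i (χ r) ∎
      where
      open ≤-Reasoning
      k+[i+1] : k + (i + 1) ≡ suc (k + i)
      k+[i+1] = trans (cong (k +_) (+-comm i 1)) (+-suc k i)

-- Arrays as functions on the natural numbers.

-- Padding with the value m, above all keys, makes sortedness at distance d a statement about
-- all positions in ℕ.
key : ∀ {m n} → Vec (Fin m) n → ℕ → ℕ
key {m} []       q       = m
key     (x ∷ xs) zero    = toℕ x
key     (x ∷ xs) (suc q) = key xs q

key-lookup : ∀ {m n} (xs : Vec (Fin m) n) i → key xs (toℕ i) ≡ toℕ (lookup xs i)
key-lookup (x ∷ xs) Fin.zero    = refl
key-lookup (x ∷ xs) (Fin.suc i) = key-lookup xs i

key-outside : ∀ {m n} (xs : Vec (Fin m) n) {q} → n ≤ q → key xs q ≡ m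
key-outside []       _         = refl
key-outside (x ∷ xs) (s≤s n≤q) = key-outside xs n≤q

key-≤ : ∀ {m n} (xs : Vec (Fin m) n) q → key xs q ≤ m
key-≤ []       q       = ≤-refl
key-≤ (x ∷ xs) zero    = <⇒≤ (Fin.toℕ<n x)
key-≤ (x ∷ xs) (suc q) = key-≤ xs q

key-inside : ∀ {m n} (xs : Vec (Fin m) n) {q} → key xs q < m → q < n
key-inside {m} {n} xs {q} lt with q <? n
... | yes q<n = q<n
... | no  q≮n = contradiction (subst (_< m) (key-outside xs (≮⇒≥ q≮n)) lt) (n≮n m)

position : ∀ n q → (∃ λ (i : Fin n) → toℕ i ≡ q) ⊎ n ≤ q
position n q with q <? n
... | yes q<n = inj₁ (fromℕ< q<n , Fin.toℕ-fromℕ< q<n)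
... | no  q≮n = inj₂ (≮⇒≥ q≮n)

module _ (i j : Fin n) (i≢j : i ≢ j) (a : Array n) where

  lookup-swapˡ : lookup (swap i j a) i ≡ lookup a j
  lookup-swapˡ = trans (lookup∘update′ i≢j (a [ i ]≔ lookup a j) _) (lookup∘update i a _)

  lookup-swapʳ : lookup (swap i j a) j ≡ lookup a i
  lookup-swapʳ = lookup∘update j (a [ i ]≔ lookup a j) _

  lookup-swap-≢ : ∀ {z} → z ≢ i → z ≢ j → lookup (swap i j a) z ≡ lookup a z
  lookup-swap-≢ z≢i z≢j =
    trans (lookup∘update′ z≢j (a [ i ]≔ lookup a j) _) (lookup∘update′ z≢i a _)

  key-swap : Swapped (toℕ j) (toℕ i) (key a) (key (swap i j a))
  key-swap = record
    { at-x      = on-keys lookup-swapʳ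
    ; at-y      = on-keys lookup-swapˡ
    ; elsewhere = λ {z} → others z
    }
    where
    on-keys : ∀ {k l} → lookup (swap i j a) k ≡ lookup a l →
              key (swap i j a) (toℕ k) ≡ key a (toℕ l)
    on-keys {k} {l} eq =
      trans (key-lookup (swap i j a) k) (trans (cong toℕ eq) (sym (key-lookup a l)))
    others : ∀ z → z ≢ toℕ j → z ≢ toℕ i → key (swap i j a) z ≡ key a z
    others z z≢j z≢i with position n z
    ... | inj₁ (k , refl) = on-keys (lookup-swap-≢ (z≢i ∘ cong toℕ) (z≢j ∘ cong toℕ))
    ... | inj₂ n≤z        = trans (key-outside (swap i j a) n≤z) (sym (key-outside a n≤z))

-- Sequences of inversion-removing exchanges.

-- Abstracts from the algorithm: the invariants below hold for any such sequence, and `R` restricts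
-- the positions it may touch.
data Run (R : Fin n → Fin n → Set) (a : Array n) : ℕ → Array n → Set where
  []   : Run R a 0 a
  step : ∀ {i j e b} → j Fin.< i → R i j → lookup a i Fin.< lookup a j →
         Run R (swap i j a) e b → Run R a (suc e) b

module _ {R : Fin n → Fin n → Set} where

  infixr 5 _++ᴿ_

  _++ᴿ_ : ∀ {a e b e′ c} → Run R a e b → Run R b e′ c → Run R a (e + e′) c
  []                ++ᴿ t = t
  step j<i r lt s ++ᴿ t = step j<i r lt (s ++ᴿ t)

  Run-map : ∀ {Q : Fin n → Fin n → Set} {a e b} → (∀ {i j} → R i j → Q i j) →
            Run R a e b → Run Q a e b
  Run-map R⇒Q []                = []
  Run-map R⇒Q (step j<i r lt s) = step j<i (R⇒Q r) lt (Run-map R⇒Q s)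

  Run-untouched : ∀ {a e b z} → (∀ {i j} → R i j → z ≢ i × z ≢ j) →
                  Run R a e b → lookup b z ≡ lookup a z
  Run-untouched avoids []                  = refl
  Run-untouched {a} avoids (step {i} {j} j<i r lt s) = trans (Run-untouched avoids s)
    (lookup-swap-≢ i j (≢-sym (Fin.<⇒≢ j<i)) a (proj₁ (avoids r)) (proj₂ (avoids r)))

  -- Exchanges between positions in `P` only permute the keys held there, so an upper bound on these
  -- keys persists.
  Run-bounded : ∀ {P : Fin n → Set} {B : Fin n} {a e b} →
                (∀ {i j} → R i j → P i × P j) → Run R a e b →
                (∀ {k} → P k → lookup a k Fin.≤ B) → ∀ {k} → P k → lookup b k Fin.≤ B
  Run-bounded within []                  bound = bound
  Run-bounded {P} {B} {a} within (step {i} {j} j<i r lt s) bound =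
    Run-bounded within s swapped
    where
    i≢j : i ≢ j
    i≢j = ≢-sym (Fin.<⇒≢ j<i)
    swapped : ∀ {k} → P k → lookup (swap i j a) k Fin.≤ B
    swapped {k} Pk with k Fin.≟ i | k Fin.≟ j
    ... | yes refl | _        =
      subst (Fin._≤ B) (sym (lookup-swapˡ i j i≢j a)) (bound (proj₂ (within r)))
    ... | no _     | yes refl =
      subst (Fin._≤ B) (sym (lookup-swapʳ i j i≢j a)) (bound (proj₁ (within r)))
    ... | no k≢i   | no k≢j   =
      subst (Fin._≤ B) (sym (lookup-swap-≢ i j i≢j a k≢i k≢j)) (bound Pk)

SameLabel : (ℕ → ℕ) → Fin n → Fin n → Set
SameLabel κ i j = κ (toℕ i) ≡ κ (toℕ j)

module _ (κ : ℕ → ℕ) where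

  Run-inversions : ∀ {a e b} → Run {n} (SameLabel κ) a e b →
                   e + inversions κ n (key b) ≤ inversions κ n (key a)
  Run-inversions []                                  = ≤-refl
  Run-inversions {a = a} (step {i} {j} j<i κi≡κj lt s) = ≤-trans (s≤s (Run-inversions s))
    (inversions-swap κ j<i (sym κi≡κj)
      (subst₂ _<_ (sym (key-lookup a i)) (sym (key-lookup a j)) lt)
      (key-swap i j (≢-sym (Fin.<⇒≢ j<i)) a) (Fin.toℕ<n i))

  Run-countBelow : ∀ {a e b} → Run {n} (SameLabel κ) a e b →
                   ∀ c t → countBelow κ n (key a) c t ≡ countBelow κ n (key b) c t
  Run-countBelow []                                  c t = refl
  Run-countBelow {a = a} (step {i} {j} j<i κi≡κj lt s) c t = trans
    (countBelow-swap κ j<i (Fin.toℕ<n i) (sym κi≡κj) (key-swap i j (≢-sym (Fin.<⇒≢ j<i)) a) c t)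
    (Run-countBelow s c t)

-- Correctness of insertion sort on one chain.

Runs : (Fin n → Fin n → Set) → Procedure n → Set
Runs R f = ∀ a → Run R a (exchanges (f a)) (array (f a))

module _ {P : Fin n → Set} where

  private
    Both : Fin n → Fin n → Set
    Both i j = P i × P j

  -- `P` is kept free for three uses: lying in a residue class, being a member of the list, and
  -- differing from a given position.
  insert-run : ∀ {i js} → AllPairs Fin._>_ (i ∷ js) → All P (i ∷ js) → Runs Both (insert i js)
  insert-run {i} {[]}     _ _ a = []
  insert-run {i} {j ∷ js} ((i>j ∷ i>js) ∷ j>js ∷ desc) (Pi ∷ Pj ∷ Pjs) a
    with lookup a i Fin.<? lookup a j
  ... | yes lt = step i>j (Pi , Pj) lt (insert-run (j>js ∷ desc) (Pj ∷ Pjs) (swap i j a))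
  ... | no  _  = []

All-reverse : ∀ {P : A → Set} {xs} → All P xs → All P (reverse xs)
All-reverse Pxs = All.tabulate (All.lookup Pxs ∘ Any.reverse⁻)

module _ {R : A → A → Set} where

  AllPairs-ʳ++⁻ : ∀ xs {ys} → AllPairs R (xs ʳ++ ys) → AllPairs R ys
  AllPairs-ʳ++⁻ []       Rys = Rys
  AllPairs-ʳ++⁻ (x ∷ xs) Rs  = AllPairs.tail (AllPairs-ʳ++⁻ xs Rs)

  AllPairs-reverse : ∀ {xs} → AllPairs R xs → AllPairs (flip R) (reverse xs)
  AllPairs-reverse {[]}     []        = []
  AllPairs-reverse {x ∷ xs} (Rx ∷ Rxs) = subst (AllPairs (flip R)) (sym (unfold-reverse x xs))
    (AllPairs.++⁺ (AllPairs-reverse Rxs) ([] ∷ []) (All.map (_∷ []) (All-reverse Rx)))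

  AllPairs-lookup : ∀ {xs x y} → AllPairs R xs → x ∈ xs → y ∈ xs → x ≡ y ⊎ R x y ⊎ R y x
  AllPairs-lookup (Rx ∷ Rxs) (here refl)  (here refl)  = inj₁ refl
  AllPairs-lookup (Rx ∷ Rxs) (here refl)  (there y∈xs) = inj₂ (inj₁ (All.lookup Rx y∈xs))
  AllPairs-lookup (Rx ∷ Rxs) (there x∈xs) (here refl)  = inj₂ (inj₂ (All.lookup Rx x∈xs))
  AllPairs-lookup (Rx ∷ Rxs) (there x∈xs) (there y∈xs) = AllPairs-lookup Rxs x∈xs y∈xs

All-ʳ++⁻ : ∀ {P : A → Set} xs {ys} → All P (xs ʳ++ ys) → All P ys
All-ʳ++⁻ []       Pys = Pys
All-ʳ++⁻ (x ∷ xs) Ps  = All.tail (All-ʳ++⁻ xs Ps)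

insertionSort-run : ∀ {P : Fin n → Set} done todo → AllPairs Fin._>_ (todo ʳ++ done) →
                    All P (todo ʳ++ done) → Runs (λ i j → P i × P j) (insertionSort done todo)
insertionSort-run done []         desc Ps a = []
insertionSort-run done (i ∷ todo) desc Ps a =
  insert-run (AllPairs-ʳ++⁻ todo desc) (All-ʳ++⁻ todo Ps) a
  ++ᴿ insertionSort-run (i ∷ done) todo desc Ps _

-- Chains are listed from right to left.
SortedChain : List (Fin n) → Array n → Set
SortedChain is a = AllPairs (λ i j → lookup a j Fin.≤ lookup a i) is

SortedChain-cong : ∀ {is} (a b : Array n) → All (λ k → lookup b k ≡ lookup a k) is →
                   SortedChain is a → SortedChain is b
SortedChain-cong a b []           []           = []
SortedChain-cong a b (eq ∷ eqs) (≤i ∷ sorted) =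
  All.zipWith (λ {k} (eqₖ , le) → subst₂ Fin._≤_ (sym eqₖ) (sym eq) le) (eqs , ≤i)
  ∷ SortedChain-cong a b eqs sorted

-- After an exchange, `i` holds the old key of `j`, the largest of the sorted part. The rest of the
-- insertion never touches `i` and only permutes the keys at `j ∷ js`, all bounded by that key.
insert-sorted : ∀ {i : Fin n} {js} → AllPairs Fin._>_ (i ∷ js) → ∀ a → SortedChain js a →
                SortedChain (i ∷ js) (array (insert i js a))
insert-sorted {i = i} {[]}     _ a _ = [] ∷ []
insert-sorted {i = i} {j ∷ js} ((i>j ∷ i>js) ∷ desc@(j>js ∷ _)) a (≤j ∷ sorted)
  with lookup a i Fin.<? lookup a j
... | no  ai≮aj = (≮⇒≥ ai≮aj ∷ All.map (λ le → ≤-trans le (≮⇒≥ ai≮aj)) ≤j) ∷ ≤j ∷ sorted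
... | yes ai<aj =
  All.tabulate (λ k∈ → subst (lookup (array (insert j js a′)) _ Fin.≤_) (sym b-i) (Run-bounded id
    (insert-run desc (All.tabulate id) a′) (All.lookup a′≤aj) k∈))
  ∷ insert-sorted desc a′ (SortedChain-cong a a′ unchanged sorted)
  where
  a′ = swap i j a
  i≢j : i ≢ j
  i≢j = ≢-sym (Fin.<⇒≢ i>j)
  unchanged : All (λ k → lookup a′ k ≡ lookup a k) js
  unchanged = All.zipWith (λ (i>k , j>k) → lookup-swap-≢ i j i≢j a (Fin.<⇒≢ i>k) (Fin.<⇒≢ j>k))
                          (i>js , j>js)
  a′≤aj : All (λ k → lookup a′ k Fin.≤ lookup a j) (j ∷ js)
  a′≤aj = subst (Fin._≤ lookup a j) (sym (lookup-swapʳ i j i≢j a)) (<⇒≤ ai<aj)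
    ∷ All.zipWith (λ (eq , le) → subst (Fin._≤ lookup a j) (sym eq) le) (unchanged , ≤j)
  b-i : lookup (array (insert j js a′)) i ≡ lookup a j
  b-i = trans
    (Run-untouched id (insert-run desc (All.map (≢-sym ∘ Fin.<⇒≢) (i>j ∷ i>js)) a′))
    (lookup-swapˡ i j i≢j a)

insertionSort-sorted : ∀ (done todo : List (Fin n)) → AllPairs Fin._>_ (todo ʳ++ done) →
  ∀ a → SortedChain done a → SortedChain (todo ʳ++ done) (array (insertionSort done todo a))
insertionSort-sorted done []         desc a sorted = sorted
insertionSort-sorted done (i ∷ todo) desc a sorted =
  insertionSort-sorted (i ∷ done) todo desc _ (insert-sorted (AllPairs-ʳ++⁻ todo desc) a sorted)

runAll-run : ∀ {R : Fin n → Fin n → Set} {fs} → All (Runs R) fs → Runs R (runAll fs)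
runAll-run []         a = []
runAll-run (Rf ∷ Rfs) a = Rf a ++ᴿ runAll-run Rfs _

runAll-preserves : ∀ {P : Array n → Set} {fs} → All (λ f → ∀ a → P a → P (array (f a))) fs →
                   ∀ a → P a → P (array (runAll fs a))
runAll-preserves []         a Pa = Pa
runAll-preserves (Pf ∷ Pfs) a Pa = runAll-preserves Pfs _ (Pf a Pa)

-- Comparisons in excess of exchanges.

-- Used at two levels: for the chains within a pass and for the passes of Shellsort.
runAll-comparisons : ∀ (F : A → Procedure n) (c : A → ℕ) →
  (∀ x a → comparisons (F x a) ≤ exchanges (F x a) + c x) →
  ∀ xs a → comparisons (runAll (map F xs) a) ≤ exchanges (runAll (map F xs) a) + sum (map c xs)
runAll-comparisons F c le []       a = z≤n
runAll-comparisons F c le (x ∷ xs) a = ≤-trans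
  (+-mono-≤ (le x a) (runAll-comparisons F c le xs _))
  (≤-reflexive (interchange +-commutativeSemigroup (exchanges (F x a)) (c x) _ _))

insert-comparisons : ∀ (i : Fin n) js a →
                     comparisons (insert i js a) ≤ exchanges (insert i js a) + 1
insert-comparisons i []       a = z≤n
insert-comparisons i (j ∷ js) a with lookup a i Fin.<? lookup a j
... | yes _ = s≤s (insert-comparisons j js (swap i j a))
... | no  _ = ≤-refl

insertionSort-comparisons : ∀ (done todo : List (Fin n)) a →
  comparisons (insertionSort done todo a) ≤ exchanges (insertionSort done todo a) + length todo
insertionSort-comparisons done []         a = z≤n
insertionSort-comparisons done (i ∷ todo) a = ≤-trans
  (+-mono-≤ (insert-comparisons i done a) (insertionSort-comparisons (i ∷ done) todo _))
  (≤-reflexive (interchange +-commutativeSemigroup (exchanges (insert i done a)) 1 _ _))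

length-filter-∷ : ∀ {P : A → Set} (P? : ∀ x → Dec (P x)) x xs →
                  length (filter P? (x ∷ xs)) ≡ 𝟙 (P? x) + length (filter P? xs)
length-filter-∷ P? x xs with P? x
... | yes _ = refl
... | no  _ = refl

-- Every element lies in at most one fibre; hence the chains of one pass have at most `n` positions
-- in total.
∑-length-fibres : ∀ (f : A → ℕ) h xs → ∑ h (λ r → length (filter (λ x → f x ≟ r) xs)) ≤ length xs
∑-length-fibres f h []       = ≤-reflexive (∑-zero h λ _ → refl)
∑-length-fibres f h (x ∷ xs) = begin
  ∑ h (λ r → length (filter (λ z → f z ≟ r) (x ∷ xs)))
    ≡⟨ ∑-cong h (λ r → length-filter-∷ (λ z → f z ≟ r) x xs) ⟩
  ∑ h (λ r → 𝟙 (f x ≟ r) + length (filter (λ z → f z ≟ r) xs))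
    ≡⟨ ∑-distrib-+ h (λ r → 𝟙 (f x ≟ r)) _ ⟩
  ∑ h (λ r → 𝟙 (f x ≟ r)) + ∑ h (λ r → length (filter (λ z → f z ≟ r) xs))
    ≤⟨ +-mono-≤ (≤-trans (∑-diagonal h (f x)) (𝟙-≤ (f x <? h) λ _ → ≤-refl))
                (∑-length-fibres f h xs) ⟩
  suc (length xs) ∎
  where open ≤-Reasoning

-- A single pass.

module _ (h : ℕ) .{{_ : NonZero h}} where

  private
    sortResidue : ℕ → Procedure n
    sortResidue {n} r = insertionSort [] (chain n h r)

    InResidue : ℕ → Fin n → Set
    InResidue r i = toℕ i % h ≡ r

  -- Chains are reversed because `insertionSort []` ends with its input list reversed as the list of
  -- finished positions.
  chain-descending : ∀ r → AllPairs Fin._>_ (reverse (chain n h r))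
  chain-descending r =
    AllPairs-reverse (AllPairs.filter⁺ (λ i → toℕ i % h ≟ r) (AllPairs.tabulate⁺-< id))

  chain-residue : ∀ r → All (InResidue r) (reverse (chain n h r))
  chain-residue {n} r = All-reverse (All.all-filter (λ i → toℕ i % h ≟ r) (allFin n))

  ∈-chain : ∀ {r} (i : Fin n) → InResidue r i → i ∈ reverse (chain n h r)
  ∈-chain {r = r} i eq = Any.reverse⁺ (∈-filter⁺ (λ i → toℕ i % h ≟ r) (∈-allFin i) eq)

  sortResidue-run : ∀ r → Runs {n} (λ i j → InResidue r i × InResidue r j) (sortResidue r)
  sortResidue-run {n} r = insertionSort-run [] (chain n h r) (chain-descending r) (chain-residue r)

  pass-run : Runs {n} (SameLabel (_% h)) (pass h)
  pass-run = runAll-run (All.map⁺ (All.universal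
    (λ r a → Run-map (λ (eqᵢ , eqⱼ) → trans eqᵢ (sym eqⱼ)) (sortResidue-run r a)) (upTo h)))

  sortResidue-sorts : ∀ r a → SortedChain (reverse (chain n h r)) (array (sortResidue r a))
  sortResidue-sorts {n} r a = insertionSort-sorted [] (chain n h r) (chain-descending r) a []

  -- Either the same chain is sorted anew, or the two residues differ and no position of chain `c`
  -- is touched.
  sortResidue-preserves : ∀ r c a → SortedChain (reverse (chain n h c)) a →
                          SortedChain (reverse (chain n h c)) (array (sortResidue r a))
  sortResidue-preserves r c a sorted with c ≟ r
  ... | yes refl = sortResidue-sorts r a
  ... | no  c≢r  = SortedChain-cong a (array (sortResidue r a))
    (All.map (λ eq → Run-untouched
      (λ (eqᵢ , eqⱼ) → (λ { refl → c≢r (trans (sym eq) eqᵢ) }) , (λ { refl → c≢r (trans (sym eq) eqⱼ) }))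
      (sortResidue-run r a)) (chain-residue c))
    sorted

  -- The turn of `c` sorts its chain from any state, and the later turns preserve this.
  sortResidues-sorts : ∀ {c rs} → c ∈ rs → ∀ a →
    SortedChain (reverse (chain n h c)) (array (runAll (map sortResidue rs) a))
  sortResidues-sorts {c = c} (here {xs = rs} refl) a = runAll-preserves
    (All.map⁺ (All.universal (λ r → sortResidue-preserves r c) rs)) _ (sortResidue-sorts c a)
  sortResidues-sorts (there c∈rs) a = sortResidues-sorts c∈rs _

  -- Along the chain, the order of positions is zipped with the order of keys; `i Fin.< j` then
  -- rules out the wrong orientation.
  pass-sorts-residue : ∀ (a : Array n) {i j} → InResidue (toℕ j % h) i → i Fin.< j →
                       lookup (array (pass h a)) i Fin.≤ lookup (array (pass h a)) j
  pass-sorts-residue {n} a {i} {j} eq i<j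
    with AllPairs-lookup (AllPairs.zip (chain-descending c , sortResidues-sorts c∈residues a))
                         (∈-chain i eq) (∈-chain j refl)
    where
    c = toℕ j % h
    c∈residues : c ∈ upTo h
    c∈residues = ∈-upTo⁺ (m%n<n (toℕ j) h)
  ... | inj₁ refl                = ≤-refl
  ... | inj₂ (inj₁ (i>j , _))    = contradiction i<j (<-asym i>j)
  ... | inj₂ (inj₂ (_ , bi≤bj)) = bi≤bj

  -- Once `h + q` leaves the array its value is the padding, which bounds every key; otherwise `q`
  -- and `h + q` lie in the same chain.
  pass-sorted : ∀ (a : Array n) → Sorted h (key (array (pass h a)))
  pass-sorted {n} a q with position n q | position n (h + q)
  ... | _ | inj₂ n≤h+q =
    ≤-trans (key-≤ b q) (≤-reflexive (sym (key-outside b n≤h+q)))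
    where b = array (pass h a)
  ... | inj₂ n≤q | inj₁ (j , j≡h+q) =
    contradiction (subst (_< n) j≡h+q (Fin.toℕ<n j)) (≤⇒≯ (≤-trans n≤q (m≤n+m q h)))
  ... | inj₁ (i , refl) | inj₁ (j , j≡h+i) = subst (λ z → key b (toℕ i) ≤ key b z) j≡h+i
    (subst₂ _≤_ (sym (key-lookup b i)) (sym (key-lookup b j)) (pass-sorts-residue a i≡j i<j))
    where
    b = array (pass h a)
    i≡j : toℕ i % h ≡ toℕ j % h
    i≡j = sym (trans (cong (_% h) (trans j≡h+i (+-comm h (toℕ i)))) ([m+n]%n≡m%n (toℕ i) h))
    i<j : i Fin.< j
    i<j = subst (toℕ i <_) (sym j≡h+i) (m<n+m (toℕ i) (>-nonZero⁻¹ h))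

  -- The pass exchanges only inside residue classes, so the class counts agree. `Sorted-preserved`
  -- is used with `n` as both the length and the padding value.
  pass-preserves-Sorted : ∀ k (a : Array n) → Sorted k (key a) → Sorted k (key (array (pass h a)))
  pass-preserves-Sorted k a sorted = Sorted-preserved h sorted (pass-sorted a)
    (key-≤ b) (key-inside b) (Run-countBelow (_% h) (pass-run a))
    where b = array (pass h a)

  pass-comparisons : ∀ (a : Array n) → comparisons (pass h a) ≤ exchanges (pass h a) + n
  pass-comparisons {n} a = ≤-trans
    (runAll-comparisons sortResidue (length ∘ chain n h)
      (λ r → insertionSort-comparisons [] (chain n h r)) (upTo h) a)
    (+-monoʳ-≤ (exchanges (pass h a)) (begin
      sum (map (length ∘ chain n h) (upTo h))  ≡⟨ cong sum (map-upTo (length ∘ chain n h) h) ⟩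
      ∑ h (length ∘ chain n h)                 ≤⟨ ∑-length-fibres (λ i → toℕ i % h) h (allFin n) ⟩
      length (allFin n)                        ≡⟨ length-tabulate id ⟩
      n                                        ∎))
    where open ≤-Reasoning

-- Sequences of passes and the resulting bounds.

-- Each procedure establishes the property for its own index, and all later ones keep it.
runAll-establishes : ∀ (P : ℕ → Array n → Set) (g : Fin p → ℕ) (f : Fin p → Procedure n) →
  (∀ j a → P (g j) (array (f j a))) → (∀ j d a → P d a → P d (array (f j a))) →
  ∀ s a → All (λ d → P d (array (runAll (take s (tabulate f)) a))) (take s (tabulate g))
runAll-establishes {p = p}     P g f est pres zero    a = []
runAll-establishes {p = zero}  P g f est pres (suc s) a = []
runAll-establishes {p = suc p} P g f est pres (suc s) a =
  runAll-preserves {P = P (g Fin.zero)}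
    (All.take⁺ s (All.tabulate⁺ λ j → pres (Fin.suc j) (g Fin.zero))) _ (est Fin.zero a)
  ∷ runAll-establishes P (g ∘ Fin.suc) (f ∘ Fin.suc) (est ∘ Fin.suc) (pres ∘ Fin.suc) s _

runAll-exchanges-++ : ∀ fs gs (a : Array n) → exchanges (runAll (fs ++ gs) a) ≡
  exchanges (runAll fs a) + exchanges (runAll gs (array (runAll fs a)))
runAll-exchanges-++ []       gs a = refl
runAll-exchanges-++ (f ∷ fs) gs a =
  trans (cong (exchanges (f a) +_) (runAll-exchanges-++ fs gs _)) (sym (+-assoc (exchanges (f a)) _ _))

runAll-exchanges-≤ : ∀ (f : Fin p → Procedure n) (c : Fin p → ℕ) s a →
  (∀ j → exchanges (f j (array (runAll (take (toℕ j) (tabulate f)) a))) ≤ c j) →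
  exchanges (runAll (take s (tabulate f)) a) ≤ sum (take s (tabulate c))
runAll-exchanges-≤ {p = p}     f c zero    a le = z≤n
runAll-exchanges-≤ {p = zero}  f c (suc s) a le = z≤n
runAll-exchanges-≤ {p = suc p} f c (suc s) a le =
  -- By computation, `le (Fin.suc j)` speaks of the remaining procedures started after the first
  -- one.
  +-mono-≤ (le Fin.zero) (runAll-exchanges-≤ (f ∘ Fin.suc) (c ∘ Fin.suc) s _ (le ∘ Fin.suc))

sum-map-const : ∀ k (xs : List A) → sum (map (λ _ → k) xs) ≡ length xs * k
sum-map-const k []       = refl
sum-map-const k (x ∷ xs) = cong (k +_) (sum-map-const k xs)

inverted⇒¬Sorted : ∀ {f : ℕ → ℕ} {d u v} → d + u ≡ v → f v < f u → ¬ Sorted d f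
inverted⇒¬Sorted {u = u} refl lt sorted = <⇒≱ lt (sorted u)

u<v⇒d≢0 : ∀ {d u v} → u < v → d + u ≡ v → NonZero d
u<v⇒d≢0 {zero}  u<v refl = contradiction u<v (n≮n _)
u<v⇒d≢0 {suc _} _   _    = _

∈-applyUpTo-suc : ∀ {m k} → NonZero m → m ≤ k → m ∈ applyUpTo suc k
∈-applyUpTo-suc {suc m} _ m<k = ∈-applyUpTo⁺ suc m<k

distance-≤ : ∀ {n d u v} → d + u ≡ v → v < n → d ≤ n ∸ 1
distance-≤ {u = u} refl v<n = ≤-trans (m≤m+n _ u) (<⇒≤pred v<n)

module _ (H : GapSequence p) where

  GapSorted : ℕ → Array n → Set
  GapSorted s a = All (λ d → Sorted d (key a)) (take s (tabulate (gap H)))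

  passes-sorted : ∀ s (σ : Array n) → GapSorted s (array (runAll (take s (passes H)) σ))
  passes-sorted = runAll-establishes (λ d a → Sorted d (key a)) (gap H) (passAt H)
    (λ j → pass-sorted (gap H j) {{positive H j}})
    (λ j → pass-preserves-Sorted (gap H j) {{positive H j}})

  passAt-exchanges-≤ : ∀ j (a : Array n) → GapSorted (toℕ j) a → exchanges (passAt H j a) ≤ D n H j
  passAt-exchanges-≤ {n} j a sorted = begin
    exchanges (passAt H j a)
      ≤⟨ m≤m+n _ _ ⟩
    exchanges (passAt H j a) + inversions (_% h) n (key (array (passAt H j a)))
      ≤⟨ Run-inversions (_% h) (pass-run h a) ⟩
    inversions (_% h) n (key a)
      ≤⟨ inversions-≤ (_% h) n (key a) (map (_* h) (G n H j)) distance ⟩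
    sum (map (n ∸_) (map (_* h) (G n H j)))
      ≡⟨ cong sum (map-∘ (G n H j)) ⟨
    D n H j ∎
    where
    open ≤-Reasoning
    h = gap H j
    instance
      h≢0 : NonZero h
      h≢0 = positive H j
    distance : ∀ {u v} → v < n → Inversion (_% h) (key a) u v →
               ∃ λ d → d ∈ map (_* h) (G n H j) × d + u ≡ v
    distance v<n (u<v , u≡v , lt) with congruent⇒multiple h (<⇒≤ u<v) u≡v
    -- Membership of `m` in `G`: it is nonzero since `u < v`, at most `M` since the distance is at
    -- most `n ∸ 1`, and `m * h` lies outside the semigroup since the array is sorted at all of its
    -- distances.
    ... | m , eq = m * h , ∈-map⁺ (_* h) (∈-filter⁺ (λ m → ¬? (S? H (toℕ j) (m * h)))
      (∈-applyUpTo-suc (m*n≢0⇒m≢0 m {{u<v⇒d≢0 u<v eq}})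
        (subst (_≤ M n H j) (m*n/n≡m m h) (/-monoˡ-≤ h (distance-≤ eq v<n))))
      (inverted⇒¬Sorted eq lt ∘ Sorted-combination sorted)) , eq

  remaining-exchanges-≤ : ∀ s (a : Array n) → GapSorted s a →
                          exchanges (runAll (drop s (passes H)) a) ≤ U n H s
  remaining-exchanges-≤ {n} s a sorted = begin
    exchanges (runAll (drop s (passes H)) a)
      ≤⟨ m≤m+n _ _ ⟩
    exchanges (runAll (drop s (passes H)) a)
      + inversions κ n (key (array (runAll (drop s (passes H)) a)))
      ≤⟨ Run-inversions κ (runAll-run (All.drop⁺ s (All.tabulate⁺ λ j a →
           Run-map (λ _ → refl) (pass-run (gap H j) {{positive H j}} a))) a) ⟩
    inversions κ n (key a)
      ≤⟨ inversions-≤ κ n (key a) _ (λ {u} {v} v<n (u<v , _ , lt) →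
           let eq = m∸n+n≡m (<⇒≤ u<v) in
           v ∸ u
           , ∈-filter⁺ (λ d → ¬? (S? H s d))
               (∈-applyUpTo-suc (u<v⇒d≢0 u<v eq) (distance-≤ eq v<n))
               (inverted⇒¬Sorted eq lt ∘ Sorted-combination sorted)
           , eq) ⟩
    U n H s ∎
    where
    open ≤-Reasoning
    -- With a constant labelling the passes of all gaps become runs for one relation and can be
    -- concatenated.
    κ : ℕ → ℕ
    κ _ = 0

  T-≤-D : ∀ (σ : Array n) j → T H j σ ≤ D n H j
  T-≤-D σ j = passAt-exchanges-≤ j (arrayBefore H j σ) (passes-sorted (toℕ j) σ)

  exchanges-≤-bound : ∀ (σ : Array n) s → exchanges (shellsort H σ) ≤ bound n H s
  exchanges-≤-bound {n} σ s = begin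
    exchanges (shellsort H σ)
      ≡⟨ cong (λ fs → exchanges (runAll fs σ)) (take++drop≡id s (passes H)) ⟨
    exchanges (runAll (take s (passes H) ++ drop s (passes H)) σ)
      ≡⟨ runAll-exchanges-++ (take s (passes H)) (drop s (passes H)) σ ⟩
    exchanges (runAll (take s (passes H)) σ)
      + exchanges (runAll (drop s (passes H)) (array (runAll (take s (passes H)) σ)))
      ≤⟨ +-mono-≤ (runAll-exchanges-≤ (passAt H) (D n H) s σ (T-≤-D σ))
                  (remaining-exchanges-≤ s _ (passes-sorted s σ)) ⟩
    bound n H s ∎
    where open ≤-Reasoning

  exchanges-≤-𝔘 : ∀ (σ : Array n) → exchanges (shellsort H σ) ≤ 𝔘 n H
  exchanges-≤-𝔘 σ = v≤min⁺ (exchanges-≤-bound σ 0)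
    (All.map⁺ (All.universal (exchanges-≤-bound σ) (upTo (suc p))))

  shellsort-comparisons : ∀ (σ : Array n) →
                          comparisons (shellsort H σ) ≤ exchanges (shellsort H σ) + n * p
  shellsort-comparisons {n} σ =
    subst₂ (λ fs k → comparisons (runAll fs σ) ≤ exchanges (runAll fs σ) + k)
      -- `passes H` is rewritten from `tabulate` to a `map` over `allFin p`, the form that
      -- `runAll-comparisons` handles.
      (map-tabulate id (passAt H)) n-each
      (runAll-comparisons (passAt H) (λ _ → n)
        (λ j → pass-comparisons (gap H j) {{positive H j}}) (allFin p) σ)
    where
    n-each : sum (map (λ _ → n) (allFin p)) ≡ n * p
    n-each = trans (sum-map-const n (allFin p))
                   (trans (cong (_* n) (length-tabulate {n = p} id)) (*-comm p n))

theorem4p1 : (n p : ℕ) → 1 ≤ n → (H : GapSequence p) →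
    ((σ : Array n) → Unique σ → (j : Fin p) → T H j σ ≤ D n H j)
    × W n H ≤ 𝔘 n H
    × C n H ≤ 𝔘 n H + n * p
theorem4p1 n p _ H =
  (λ σ _ → T-≤-D H σ)
  -- Here `z≤n` covers the base value 0 of the maximum.
  , max≤v⁺ z≤n (All.map⁺ (All.universal (exchanges-≤-𝔘 H) (inputs n)))
  , max≤v⁺ z≤n (All.map⁺ (All.universal
      (λ σ → ≤-trans (shellsort-comparisons H σ) (+-monoˡ-≤ (n * p) (exchanges-≤-𝔘 H σ)))
      (inputs n)))
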